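{- Let $k$ be an integer with $k\equiv 2\pmod 4$ and $k\ge 6$. Then the Möbius ladder $M_k$ satisfies $ced(M_k)=cvd(M_k)=1$.
   Context: Graphs are finite and may have multiple edges but not loops. A binary labeling of a graph $G$ is a function $f:V(G)\to\{0,1\}$. Two real numbers $x,y$ are roughly equal if $0\le |x-y|\le 1$. A binary labeling $f$ is friendly if $|f^{ -1}(0)|$ and $|f^{ -1}(1)|$ are roughly equal. A binary labeling $f$ induces an edge labeling $f_e:E(G)\to\{0,1\}$ by $f_e(uv)=f(u)+f(v)$ modulo 2. A friendly labeling $f$ of $G$ is cordial if $|f_e^{ -1}(0)|$ and $|f_e^{ -1}(1)|$ are roughly equal. The cordial edge deficiency $ced(G)$ is the minimum, over all friendly labelings $f$ of $G$, of the number of edges that must be added to $G$ between pairs of distinct vertices of $G$ (multiple edges allowed) so that $f$ becomes a cordial labeling of the augmented graph $G'$. The cordial vertex deficiency $cvd(G)$ is the minimum, over all binary labelings $f$ of $G$ (not necessarily friendly) for which $|f_e^{ -1}(0)|$ and $|f_e^{ -1}(1)|$ are roughly equal, of the number of labeled vertices (added as isolated vertices, with labels in $\{0,1\}$ chosen appropriately) that must be added to $G$ so that the resulting labeling of the augmented graph $G'$ is cordial; if no such binary labeling exists, $cvd(G)=\infty$. The Möbius ladder $M_k$ consists of the cycle $C_{2k}$ together with $k$ additional edges joining the opposite pairs of vertices of the cycle. -}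

module Defs where

open import Data.Fin.Base using (Fin; toℕ; _↑ˡ_)
open import Data.Fin.Properties using (toℕ<n; toℕ-fromℕ<; ↑ˡ-injective; nonZeroIndex)
open import Data.List.Base using (List; _++_; allFin; filter; length; map; tabulate)
open import Data.Nat.Base
open import Data.Nat.DivMod using (_mod_; m%n<n; m<n⇒m%n≡m; m≤n⇒[n∸m]%m≡n%m)
open import Data.Nat.Properties
open import Data.Parity.Base as ℙ using (Parity; 0ℙ; 1ℙ)
import Data.Parity.Properties as ℙ
open import Data.Product.Base using (_×_; _,_; ∃-syntax)
import Data.Vec.Functional as Vector
open import Function.Base using (_∘_)
open import Relation.Binary.PropositionalEquality
open import Relation.Nullary.Construct.Add.Supremum using (_⁺; [_]; ⊤⁺)
open import Relation.Nullary.Decidable.Core using (yes; no)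
open import Relation.Nullary.Negation.Core using (¬_; contradiction)

-- The edge joining `source` and `target` is undirected: nothing below depends
-- on the order in which its two ends are listed.
record Edge (n : ℕ) : Set where
  constructor edge
  field
    source target : Fin n
    distinct      : source ≢ target

-- Repetitions in `edges` are multiple edges.
record Graph : Set where
  constructor graph
  field
    order : ℕ
    edges : List (Edge order)

open Graph public

RoughlyEqual : ℕ → ℕ → Set
RoughlyEqual x y = ∣ x - y ∣ ≤ 1

-- `Parity` is {0 , 1} with addition modulo 2.
Labeling : Graph → Set
Labeling G = Fin (order G) → Parity

edgeLabel : ∀ {n} → (Fin n → Parity) → Edge n → Parity
edgeLabel f (edge u v _) = f u ℙ.+ f v

#vertices : (G : Graph) → Labeling G → Parity → ℕ
#vertices G f b = length (filter (λ v → f v ℙ.≟ b) (allFin (order G)))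

#edges : (G : Graph) → Labeling G → Parity → ℕ
#edges G f b = length (filter (λ e → edgeLabel f e ℙ.≟ b) (edges G))

Friendly : (G : Graph) → Labeling G → Set
Friendly G f = RoughlyEqual (#vertices G f 0ℙ) (#vertices G f 1ℙ)

EdgeBalanced : (G : Graph) → Labeling G → Set
EdgeBalanced G f = RoughlyEqual (#edges G f 0ℙ) (#edges G f 1ℙ)

Cordial : (G : Graph) → Labeling G → Set
Cordial G f = Friendly G f × EdgeBalanced G f

addEdges : (G : Graph) → List (Edge (order G)) → Graph
addEdges (graph n es) es′ = graph n (es ++ es′)

weaken : ∀ {n} p → Edge n → Edge (n + p)
weaken p (edge u v u≢v) = edge (u ↑ˡ p) (v ↑ˡ p) (u≢v ∘ ↑ˡ-injective p u v)

addVertices : Graph → ℕ → Graph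
addVertices (graph n es) p = graph (n + p) (map (weaken p) es)

extend : (G : Graph) → Labeling G → ∀ {p} → (Fin p → Parity) → Labeling (addVertices G p)
extend G f g = f Vector.++ g

IsMinimum : (ℕ → Set) → ℕ → Set
IsMinimum P m = P m × (∀ n → P n → m ≤ n)

EdgesNeeded : (G : Graph) → Labeling G → ℕ → Set
EdgesNeeded G f =
  IsMinimum λ m → ∃[ es ] length es ≡ m × Cordial (addEdges G es) f

VerticesNeeded : (G : Graph) → Labeling G → ℕ → Set
VerticesNeeded G f =
  IsMinimum λ p → ∃[ g ] Cordial (addVertices G p) (extend G f {p} g)

-- `Ced G m` says that ced(G) = m. A friendly labeling that no set of
-- additional edges makes cordial does not contribute to the minimum.
Ced : Graph → ℕ → Set
Ced G = IsMinimum λ m → ∃[ f ] Friendly G f × EdgesNeeded G f m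

-- `Cvd G x` says that cvd(G) = x, where ⊤⁺ is ∞.
Cvd : Graph → ℕ ⁺ → Set
Cvd G [ m ] = IsMinimum (λ p → ∃[ f ] EdgeBalanced G f × VerticesNeeded G f p) m
Cvd G ⊤⁺    = ¬ (∃[ f ] EdgeBalanced G f)

infixl 6 _⊕_
_⊕_ : ∀ {n} → Fin n → ℕ → Fin n
_⊕_ {n} i d = ((toℕ i + d) mod n) {{nonZeroIndex i}}

⊕-distinct : ∀ {n} (i : Fin n) {d} → 0 < d → d < n → i ≢ i ⊕ d
⊕-distinct {n@(suc _)} i {d} 0<d d<n i≡i⊕d with toℕ i + d <? n
... | yes i+d<n = <⇒≢ (m<m+n (toℕ i) 0<d) (begin
  toℕ i            ≡⟨ cong toℕ i≡i⊕d ⟩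
  toℕ (i ⊕ d)      ≡⟨ toℕ-fromℕ< (m%n<n (toℕ i + d) n) ⟩
  (toℕ i + d) % n  ≡⟨ m<n⇒m%n≡m i+d<n ⟩
  toℕ i + d        ∎)
  where open ≡-Reasoning
... | no i+d≮n = <⇒≢ d<n (+-cancelˡ-≡ (toℕ i) d n (begin
  toℕ i + d              ≡⟨ m∸n+n≡m n≤i+d ⟨
  toℕ i + d ∸ n + n      ≡⟨ cong (_+ n) (m<n⇒m%n≡m i+d∸n<n) ⟨
  (toℕ i + d ∸ n) % n + n ≡⟨ cong (_+ n) (m≤n⇒[n∸m]%m≡n%m n≤i+d) ⟩
  (toℕ i + d) % n + n    ≡⟨ cong (_+ n) (toℕ-fromℕ< (m%n<n (toℕ i + d) n)) ⟨
  toℕ (i ⊕ d) + n        ≡⟨ cong (λ j → toℕ j + n) i≡i⊕d ⟨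
  toℕ i + n              ∎))
  where
  open ≡-Reasoning
  n≤i+d : n ≤ toℕ i + d
  n≤i+d = ≮⇒≥ i+d≮n
  i+d∸n<n : toℕ i + d ∸ n < n
  i+d∸n<n = m<n+o⇒m∸n<o (toℕ i + d) n (+-mono-< (toℕ<n i) d<n)

0<k : ∀ {k} → Fin k → 0 < k
0<k {suc _} _ = z<s

k<2k : ∀ {k} → 0 < k → k < 2 * k
k<2k {k} p = m<m+n k (≤-trans p (m≤m+n k 0))

1<2k : ∀ {k} → Fin (2 * k) → 1 < 2 * k
1<2k {suc k} _ = ≤-<-trans (s≤s z≤n) (k<2k {suc k} z<s)

-- The vertices 0 , … , 2k - 1 are listed in their order around the cycle.
cycleEdges : ∀ k → List (Edge (2 * k))
cycleEdges k = tabulate λ i → edge i (i ⊕ 1) (⊕-distinct i z<s (1<2k {k} i))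

-- Each opposite pair is listed once, from its member in the first half.
oppositeEdges : ∀ k → List (Edge (2 * k))
oppositeEdges k = tabulate {n = k} λ i →
  edge (i ↑ˡ _) ((i ↑ˡ _) ⊕ k) (⊕-distinct (i ↑ˡ _) (0<k i) (k<2k (0<k i)))

möbiusLadder : ℕ → Graph
möbiusLadder k = graph (2 * k) (cycleEdges k ++ oppositeEdges k)

{-# OPTIONS --safe #-}

-- Every vertex of M_k has degree 3, so modulo 2 the number of edges labeled 1
-- is the number of vertices labeled 1.  In a cordial labeling of M_k these two
-- numbers would be 3k/2 and k, which differ in parity when k ≡ 2 (mod 4).
-- Hence both deficiencies are at least 1.
--
-- For the upper bounds, read M_k as a ladder whose rungs are the opposite pairs
-- and label it column by column: (0,0), (y,1), and then the columns
-- (0,0), (0,1), (1,1), (1,0) repeated.  Each repetition is balanced both on its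
-- vertices and on its edges, and the labels agree across the twist.  The choice
-- y = 1 gives a friendly labeling with two more edges labeled 1 than 0; the
-- choice y = 0 gives equally many edges of both labels and two more vertices
-- labeled 0 than 1.
module Submission where

open import Defs
open import Data.Fin.Base using (Fin; zero; suc; toℕ; _↑ˡ_; _↑ʳ_)
open import Data.Fin.Properties using (toℕ<n; toℕ-fromℕ<; toℕ-↑ˡ; toℕ-injective; fromℕ<-cong; nonZeroIndex)
open import Data.List.Base using (List; []; _∷_; _++_; allFin; filter; length; map; tabulate)
open import Data.List.Properties using (filter-++; length-++; length-tabulate)
open import Data.Nat.Base using (ℕ; zero; suc; _+_; _*_; _/_; _%_; _≤_; _<_; z≤n; s≤s; z<s; NonZero; >-nonZero⁻¹; parity)
open import Data.Nat.DivMod using (_mod_; m%n<n; m<n⇒m%n≡m; m≡m%n+[m/n]*n; n%n≡0)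
open import Data.Nat.Properties
open import Data.Nat.Tactic.RingSolver using (solve-∀)
open import Data.Parity.Base as ℙ using (Parity; 0ℙ; 1ℙ)
import Data.Parity.Properties as ℙ
open import Algebra.Properties.CommutativeSemigroup ℙ.+-commutativeSemigroup using (interchange)
open import Data.Product.Base using (_×_; _,_; ∃-syntax)
open import Data.Sum.Base using (inj₁; inj₂)
import Data.Vec.Functional as Vector
open import Data.Vec.Functional.Properties using (lookup-++ˡ; lookup-++ʳ)
open import Function.Base using (_∘_; id)
open import Relation.Binary.PropositionalEquality
open import Relation.Nullary.Construct.Add.Supremum using ([_])
open import Relation.Nullary.Negation.Core using (¬_; contradiction)

open ≡-Reasoning

-- Counting labels in lists

δ : Parity → Parity → ℕ
δ 0ℙ 0ℙ = 1
δ 0ℙ 1ℙ = 0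
δ 1ℙ 0ℙ = 0
δ 1ℙ 1ℙ = 1

parity-δ₁ : ∀ p → parity (δ 1ℙ p) ≡ p
parity-δ₁ 0ℙ = refl
parity-δ₁ 1ℙ = refl

δ-total : ∀ p → δ 0ℙ p + δ 1ℙ p ≡ 1
δ-total 0ℙ = refl
δ-total 1ℙ = refl

-- Both `#vertices G f` and `#edges G f` are definitionally instances of this, so the lemmas below
-- apply to either.
count : ∀ {A : Set} → (A → Parity) → Parity → List A → ℕ
count g b xs = length (filter (λ x → g x ℙ.≟ b) xs)

module _ {A : Set} (g : A → Parity) where

  count-∷ : ∀ b x xs → count g b (x ∷ xs) ≡ δ b (g x) + count g b xs
  count-∷ 0ℙ x xs with g x
  ... | 0ℙ = refl
  ... | 1ℙ = refl
  count-∷ 1ℙ x xs with g x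
  ... | 0ℙ = refl
  ... | 1ℙ = refl

  count-++ : ∀ b xs ys → count g b (xs ++ ys) ≡ count g b xs + count g b ys
  count-++ b xs ys = trans (cong length (filter-++ _ xs ys)) (length-++ (filter _ xs))

  count-total : ∀ xs → count g 0ℙ xs + count g 1ℙ xs ≡ length xs
  count-total []       = refl
  count-total (x ∷ xs) = begin
    count g 0ℙ (x ∷ xs) + count g 1ℙ (x ∷ xs)  ≡⟨ cong₂ _+_ (count-∷ 0ℙ x xs) (count-∷ 1ℙ x xs) ⟩
    (δ 0ℙ (g x) + c₀) + (δ 1ℙ (g x) + c₁)      ≡⟨ rearrange (δ 0ℙ (g x)) c₀ (δ 1ℙ (g x)) c₁ ⟩
    (δ 0ℙ (g x) + δ 1ℙ (g x)) + (c₀ + c₁)      ≡⟨ cong₂ _+_ (δ-total (g x)) (count-total xs) ⟩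
    suc (length xs)                            ∎
    where
    c₀ = count g 0ℙ xs
    c₁ = count g 1ℙ xs
    rearrange : ∀ a b c d → (a + b) + (c + d) ≡ (a + c) + (b + d)
    rearrange = solve-∀

  -- As `allFin` is `tabulate id`, this separates the old vertices of `addVertices G p` from the
  -- added ones.
  count-tabulate-+ : ∀ b n {p} (e : Fin (n + p) → A) →
    count g b (tabulate e) ≡
    count g b (tabulate (e ∘ (_↑ˡ p))) + count g b (tabulate (e ∘ (n ↑ʳ_)))
  count-tabulate-+ b zero        e = refl
  count-tabulate-+ b (suc n) {p} e = begin
    count g b (tabulate e)       ≡⟨ count-∷ b (e zero) _ ⟩
    d + count g b (tabulate (e ∘ suc))
                                 ≡⟨ cong (d +_) (count-tabulate-+ b n (e ∘ suc)) ⟩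
    d + (l + r)                  ≡⟨ +-assoc d l r ⟨
    d + l + r                    ≡⟨ cong (_+ r) (count-∷ b (e zero) _) ⟨
    count g b (tabulate (e ∘ (_↑ˡ p))) + r ∎
    where
    d = δ b (g (e zero))
    l = count g b (tabulate (e ∘ suc ∘ (_↑ˡ p)))
    r = count g b (tabulate (e ∘ suc ∘ (n ↑ʳ_)))

count-map : ∀ {A B : Set} {g : A → Parity} {h : B → Parity} {φ : A → B} →
  (∀ x → h (φ x) ≡ g x) → ∀ b xs → count h b (map φ xs) ≡ count g b xs
count-map                 eq b []       = refl
count-map {g = g} {h} {φ} eq b (x ∷ xs) = begin
  count h b (φ x ∷ map φ xs)             ≡⟨ count-∷ h b (φ x) _ ⟩
  δ b (h (φ x)) + count h b (map φ xs)   ≡⟨ cong₂ (λ p c → δ b p + c) (eq x) (count-map eq b xs) ⟩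
  δ b (g x) + count g b xs               ≡⟨ count-∷ g b x xs ⟨
  count g b (x ∷ xs)                     ∎

count-tabulate-cong : ∀ {A B : Set} {g : A → Parity} {h : B → Parity} b {n}
  {d : Fin n → A} {e : Fin n → B} → (∀ i → g (d i) ≡ h (e i)) →
  count g b (tabulate d) ≡ count h b (tabulate e)
count-tabulate-cong                 b {zero}          eq = refl
count-tabulate-cong {g = g} {h = h} b {suc n} {d} {e} eq = begin
  count g b (tabulate d)         ≡⟨ count-∷ g b (d zero) _ ⟩
  δ b (g (d zero)) + count g b (tabulate (d ∘ suc))
    ≡⟨ cong₂ (λ p c → δ b p + c) (eq zero) (count-tabulate-cong b (eq ∘ suc)) ⟩
  δ b (h (e zero)) + count h b (tabulate (e ∘ suc))
                                 ≡⟨ count-∷ h b (e zero) _ ⟨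
  count h b (tabulate e)         ∎

-- Counting labels along a sequence

-- Indexing by ℕ instead of `Fin n` makes shifting, splitting and periodicity plain arithmetic on
-- indices.
tally : Parity → (ℕ → Parity) → ℕ → ℕ
tally b h zero    = 0
tally b h (suc n) = δ b (h 0) + tally b (h ∘ suc) n

count-tabulate : ∀ {A : Set} {g : A → Parity} b {n} {e : Fin n → A} {h} →
  (∀ i → g (e i) ≡ h (toℕ i)) → count g b (tabulate e) ≡ tally b h n
count-tabulate         b {zero}      eq = refl
count-tabulate {g = g} b {suc n} {e} eq =
  trans (count-∷ g b (e zero) _)
        (cong₂ (λ p c → δ b p + c) (eq zero) (count-tabulate b (eq ∘ suc)))

tally-cong : ∀ b {g h} n → (∀ i → i < n → g i ≡ h i) → tally b g n ≡ tally b h n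
tally-cong b zero    eq = refl
tally-cong b (suc n) eq =
  cong₂ (λ p c → δ b p + c) (eq 0 z<s) (tally-cong b n (λ i i<n → eq (suc i) (s≤s i<n)))

tally-+ : ∀ b h m n → tally b h (m + n) ≡ tally b h m + tally b (h ∘ (m +_)) n
tally-+ b h zero    n = refl
tally-+ b h (suc m) n =
  trans (cong (δ b (h 0) +_) (tally-+ b (h ∘ suc) m n))
        (sym (+-assoc (δ b (h 0)) _ _))

tally-periodic : ∀ b {h} p → (∀ i → h (p + i) ≡ h i) →
  ∀ q → tally b h (q * p) ≡ q * tally b h p
tally-periodic b     p eq zero    = refl
tally-periodic b {h} p eq (suc q) = begin
  tally b h (p + q * p)                           ≡⟨ tally-+ b h p (q * p) ⟩
  tally b h p + tally b (h ∘ (p +_)) (q * p)      ≡⟨ cong (tally b h p +_) (tally-cong b (q * p) (λ i _ → eq i)) ⟩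
  tally b h p + tally b h (q * p)                 ≡⟨ cong (tally b h p +_) (tally-periodic b p eq q) ⟩
  suc q * tally b h p                             ∎

-- Number of ones modulo 2

parity-tally-suc : ∀ h n → parity (tally 1ℙ h (suc n)) ≡ h 0 ℙ.+ parity (tally 1ℙ (h ∘ suc) n)
parity-tally-suc h n =
  trans (ℙ.+-homo-+ (δ 1ℙ (h 0)) (tally 1ℙ (h ∘ suc) n)) (cong (ℙ._+ parity (tally 1ℙ (h ∘ suc) n)) (parity-δ₁ (h 0)))

-- Modulo 2 the number of ones in a sequence is the sum of its terms, and sums are additive.
parity-tally-⊕ : ∀ g h n →
  parity (tally 1ℙ (λ i → g i ℙ.+ h i) n) ≡ parity (tally 1ℙ g n) ℙ.+ parity (tally 1ℙ h n)
parity-tally-⊕ g h zero    = refl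
parity-tally-⊕ g h (suc n) = begin
  parity (tally 1ℙ (λ i → g i ℙ.+ h i) (suc n))
    ≡⟨ parity-tally-suc (λ i → g i ℙ.+ h i) n ⟩
  (g 0 ℙ.+ h 0) ℙ.+ parity (tally 1ℙ (λ i → g (suc i) ℙ.+ h (suc i)) n)
    ≡⟨ cong ((g 0 ℙ.+ h 0) ℙ.+_) (parity-tally-⊕ (g ∘ suc) (h ∘ suc) n) ⟩
  (g 0 ℙ.+ h 0) ℙ.+ (parity (tally 1ℙ (g ∘ suc) n) ℙ.+ parity (tally 1ℙ (h ∘ suc) n))
    ≡⟨ interchange (g 0) (h 0) _ _ ⟩
  (g 0 ℙ.+ parity (tally 1ℙ (g ∘ suc) n)) ℙ.+ (h 0 ℙ.+ parity (tally 1ℙ (h ∘ suc) n))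
    ≡⟨ cong₂ ℙ._+_ (parity-tally-suc g n) (parity-tally-suc h n) ⟨
  parity (tally 1ℙ g (suc n)) ℙ.+ parity (tally 1ℙ h (suc n)) ∎

-- Each interior term occurs in two consecutive summands and cancels. Around a closed cycle the two
-- ends cancel as well, so evenly many of its edges are labeled 1.
parity-tally-telescope : ∀ h n → parity (tally 1ℙ (λ i → h i ℙ.+ h (suc i)) n) ≡ h 0 ℙ.+ h n
parity-tally-telescope h zero    = sym (ℙ.p+p≡0ℙ (h 0))
parity-tally-telescope h (suc n) = begin
  parity (tally 1ℙ (λ i → h i ℙ.+ h (suc i)) (suc n))
    ≡⟨ parity-tally-suc (λ i → h i ℙ.+ h (suc i)) n ⟩
  (h 0 ℙ.+ h 1) ℙ.+ parity (tally 1ℙ (λ i → h (suc i) ℙ.+ h (suc (suc i))) n)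
    ≡⟨ cong ((h 0 ℙ.+ h 1) ℙ.+_) (parity-tally-telescope (h ∘ suc) n) ⟩
  (h 0 ℙ.+ h 1) ℙ.+ (h 1 ℙ.+ h (suc n))
    ≡⟨ ℙ.+-assoc (h 0) (h 1) _ ⟩
  h 0 ℙ.+ (h 1 ℙ.+ (h 1 ℙ.+ h (suc n)))
    ≡⟨ cong (h 0 ℙ.+_) (ℙ.+-assoc (h 1) (h 1) _) ⟨
  h 0 ℙ.+ ((h 1 ℙ.+ h 1) ℙ.+ h (suc n))
    ≡⟨ cong (λ p → h 0 ℙ.+ (p ℙ.+ h (suc n))) (ℙ.p+p≡0ℙ (h 1)) ⟩
  h 0 ℙ.+ h (suc n) ∎

-- Adding edges and vertices

#edges-addEdges : ∀ G f b es → #edges (addEdges G es) f b ≡ #edges G f b + count (edgeLabel f) b es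
#edges-addEdges G f b es = count-++ (edgeLabel f) b (edges G) es

-- Added vertices are isolated, and the ends of an old edge keep their labels under `_↑ˡ_`.
#edges-addVertices : ∀ G f {p} (g : Fin p → Parity) b →
  #edges (addVertices G p) (extend G f g) b ≡ #edges G f b
#edges-addVertices G f g b =
  count-map {h = edgeLabel (extend G f g)}
    (λ { (edge u v _) → cong₂ ℙ._+_ (lookup-++ˡ f g u) (lookup-++ˡ f g v) })
    b (edges G)

#vertices-addVertices : ∀ G f {p} (g : Fin p → Parity) b →
  #vertices (addVertices G p) (extend G f g) b ≡ #vertices G f b + count g b (allFin p)
#vertices-addVertices G f g b =
  trans (count-tabulate-+ (extend G f g) b (order G) id)
        (cong₂ _+_ (count-tabulate-cong b (lookup-++ˡ f g)) (count-tabulate-cong b (lookup-++ʳ f g)))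

-- For excluding deficiency 0. The order of `addVertices G 0` is a sum with 0, so the counts have to
-- be transported.
0-vertices-cordial : ∀ G {f g} → Cordial (addVertices G 0) (extend G f {0} g) → Cordial G f
0-vertices-cordial G {f} {g} (fr , ba) =
  subst₂ RoughlyEqual (v 0ℙ) (v 1ℙ) fr ,
  subst₂ RoughlyEqual (#edges-addVertices G f g 0ℙ) (#edges-addVertices G f g 1ℙ) ba
  where
  v : ∀ b → #vertices (addVertices G 0) (extend G f g) b ≡ #vertices G f b
  v b = trans (#vertices-addVertices G f g b) (+-identityʳ _)

0-edges-cordial : ∀ G {f} → Cordial (addEdges G []) f → Cordial G f
0-edges-cordial G {f} (fr , ba) = fr , subst₂ RoughlyEqual (e 0ℙ) (e 1ℙ) ba
  where
  e : ∀ b → #edges (addEdges G []) f b ≡ #edges G f b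
  e b = trans (#edges-addEdges G f b []) (+-identityʳ _)

-- Roughly equal numbers

n≈n : ∀ n → RoughlyEqual n n
n≈n n = ≤-trans (≤-reflexive (∣n-n∣≡0 n)) z≤n

n≈1+n : ∀ n → RoughlyEqual n (suc n)
n≈1+n zero    = ≤-refl
n≈1+n (suc n) = n≈1+n n

-- The distance has the parity of the sum, so if it is at most 1 and the sum is even, it is 0.
-- Removing one from both numbers keeps the distance and the parity of the sum.
roughlyEqual∧even⇒≡ : ∀ m n → RoughlyEqual m n → parity (m + n) ≡ 0ℙ → m ≡ n
roughlyEqual∧even⇒≡ zero          zero          _          _    = refl
roughlyEqual∧even⇒≡ zero          (suc zero)    _          ()
roughlyEqual∧even⇒≡ zero          (suc (suc n)) (s≤s ())
roughlyEqual∧even⇒≡ (suc zero)    zero          _          ()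
roughlyEqual∧even⇒≡ (suc (suc m)) zero          (s≤s ())
roughlyEqual∧even⇒≡ (suc m)       (suc n)       m≈n        even =
  cong suc (roughlyEqual∧even⇒≡ m n m≈n (trans (sym (cong (parity ∘ suc) (+-suc m n))) even))

-- Turns friendliness and edge balance into exact numbers of ones when the totals are even.
roughlyEqual⇒half : ∀ m n {s} → RoughlyEqual m n → m + n ≡ 2 * s → n ≡ s
roughlyEqual⇒half m n {s} m≈n m+n≡2s = *-cancelˡ-≡ n s 2 (begin
  n + (n + 0)  ≡⟨ cong (n +_) (+-identityʳ n) ⟩
  n + n        ≡⟨ cong (_+ n) m≡n ⟨
  m + n        ≡⟨ m+n≡2s ⟩
  2 * s        ∎)
  where
  m≡n : m ≡ n
  m≡n = roughlyEqual∧even⇒≡ m n m≈n (trans (cong parity m+n≡2s) (ℙ.*-homo-* 2 s))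

-- Counts in the Möbius ladder

toℕ-⊕ : ∀ {n} (i : Fin n) d → toℕ (i ⊕ d) ≡ _%_ (toℕ i + d) n {{nonZeroIndex i}}
toℕ-⊕ {n} i d = toℕ-fromℕ< (m%n<n (toℕ i + d) n {{nonZeroIndex i}})

module _ {n} (f : Fin n → Parity) (F : ℕ → Parity)
         (f≗F : ∀ i → f i ≡ F (toℕ i)) (F-closed : F n ≡ F 0) where

  -- The bound admits the index `n`, where `_⊕_` wraps to 0 and `F-closed` makes up for it. Thus the
  -- edge closing the cycle is read like every other one.
  label-⊕ : ∀ i d → toℕ i + d ≤ n → f (i ⊕ d) ≡ F (toℕ i + d)
  label-⊕ i d i+d≤n = trans (f≗F (i ⊕ d)) (trans (cong F (toℕ-⊕ i d)) wrap)
    where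
    instance _ = nonZeroIndex i
    wrap : F ((toℕ i + d) % n) ≡ F (toℕ i + d)
    wrap with m≤n⇒m<n∨m≡n i+d≤n
    ... | inj₁ i+d<n = cong F (m<n⇒m%n≡m i+d<n)
    ... | inj₂ i+d≡n = begin
      F ((toℕ i + d) % n)  ≡⟨ cong (λ j → F (j % n)) i+d≡n ⟩
      F (n % n)            ≡⟨ cong F (n%n≡0 n) ⟩
      F 0                  ≡⟨ F-closed ⟨
      F n                  ≡⟨ cong F i+d≡n ⟨
      F (toℕ i + d)        ∎

module _ (k : ℕ) (f : Labeling (möbiusLadder k)) (F : ℕ → Parity)
         (f≗F : ∀ i → f i ≡ F (toℕ i)) (F-closed : F (2 * k) ≡ F 0) where

  #vertices-möbius : ∀ b → #vertices (möbiusLadder k) f b ≡ tally b F (2 * k)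
  #vertices-möbius b = count-tabulate b f≗F

  #edges-möbius : ∀ b → #edges (möbiusLadder k) f b ≡
    tally b (λ i → F i ℙ.+ F (suc i)) (2 * k) + tally b (λ i → F i ℙ.+ F (k + i)) k
  #edges-möbius b =
    trans (count-++ (edgeLabel f) b (cycleEdges k) (oppositeEdges k))
          (cong₂ _+_ (count-tabulate b cycle) (count-tabulate b opposite))
    where
    cycle : ∀ i → f i ℙ.+ f (i ⊕ 1) ≡ F (toℕ i) ℙ.+ F (suc (toℕ i))
    cycle i = cong₂ ℙ._+_ (f≗F i)
      (trans (label-⊕ f F f≗F F-closed i 1 (subst (_≤ 2 * k) (+-comm 1 (toℕ i)) (toℕ<n i)))
             (cong F (+-comm (toℕ i) 1)))
    opposite : ∀ (i : Fin k) →
      f (i ↑ˡ _) ℙ.+ f ((i ↑ˡ _) ⊕ k) ≡ F (toℕ i) ℙ.+ F (k + toℕ i)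
    opposite i = cong₂ ℙ._+_
      (trans (f≗F (i ↑ˡ _)) (cong F i↑≡i))
      (trans (label-⊕ f F f≗F F-closed (i ↑ˡ _) k
               (subst (_≤ 2 * k) (sym i↑+k≡k+i) (+-monoʳ-≤ k (≤-trans (<⇒≤ (toℕ<n i)) (m≤m+n k 0)))))
             (cong F i↑+k≡k+i))
      where
      i↑≡i : toℕ (i ↑ˡ (k + 0)) ≡ toℕ i
      i↑≡i = toℕ-↑ˡ i (k + 0)
      i↑+k≡k+i : toℕ (i ↑ˡ (k + 0)) + k ≡ k + toℕ i
      i↑+k≡k+i = trans (cong (_+ k) i↑≡i) (+-comm (toℕ i) k)

-- Parity obstruction

2*k≡k+k : ∀ k → 2 * k ≡ k + k
2*k≡k+k k = cong (k +_) (+-identityʳ k)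

length-möbius-edges : ∀ k → length (edges (möbiusLadder k)) ≡ 2 * k + k
length-möbius-edges k =
  trans (length-++ (cycleEdges k)) (cong₂ _+_ (length-tabulate {n = 2 * k} _) (length-tabulate {n = k} _))

-- The cycle contributes an even number of ones by telescoping. The opposite pairs partition the
-- vertices, so the labels of their edges add up to the sum of all vertex labels.
parity-#edges-möbius : ∀ k .{{_ : NonZero (2 * k)}} f →
  parity (#edges (möbiusLadder k) f 1ℙ) ≡ parity (#vertices (möbiusLadder k) f 1ℙ)
parity-#edges-möbius k f = begin
  parity (#edges (möbiusLadder k) f 1ℙ)
    ≡⟨ cong parity (#edges-möbius k f F f≗F F-closed 1ℙ) ⟩
  parity (tally 1ℙ (λ i → F i ℙ.+ F (suc i)) (2 * k) + tally 1ℙ (λ i → F i ℙ.+ F (k + i)) k)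
    ≡⟨ ℙ.+-homo-+ (tally 1ℙ (λ i → F i ℙ.+ F (suc i)) (2 * k)) _ ⟩
  parity (tally 1ℙ (λ i → F i ℙ.+ F (suc i)) (2 * k)) ℙ.+ parity (tally 1ℙ (λ i → F i ℙ.+ F (k + i)) k)
    ≡⟨ cong₂ ℙ._+_ cycle (parity-tally-⊕ F (F ∘ (k +_)) k) ⟩
  parity (tally 1ℙ F k) ℙ.+ parity (tally 1ℙ (F ∘ (k +_)) k)
    ≡⟨ ℙ.+-homo-+ (tally 1ℙ F k) _ ⟨
  parity (tally 1ℙ F k + tally 1ℙ (F ∘ (k +_)) k)
    ≡⟨ cong parity (tally-+ 1ℙ F k k) ⟨
  parity (tally 1ℙ F (k + k))
    ≡⟨ cong (parity ∘ tally 1ℙ F) (2*k≡k+k k) ⟨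
  parity (tally 1ℙ F (2 * k))
    ≡⟨ cong parity (#vertices-möbius k f F f≗F F-closed 1ℙ) ⟨
  parity (#vertices (möbiusLadder k) f 1ℙ) ∎
  where
  -- The extension of `f` with period `2 * k`, which is closed for any labeling.
  F : ℕ → Parity
  F i = f (i mod (2 * k))
  f≗F : ∀ i → f i ≡ F (toℕ i)
  f≗F i = cong f (toℕ-injective (sym (trans (toℕ-fromℕ< _) (m<n⇒m%n≡m (toℕ<n i)))))
  F-closed : F (2 * k) ≡ F 0
  F-closed = cong f (fromℕ<-cong _ _
    (trans (n%n≡0 (2 * k)) (sym (m<n⇒m%n≡m (>-nonZero⁻¹ (2 * k))))) _ _)
  cycle : parity (tally 1ℙ (λ i → F i ℙ.+ F (suc i)) (2 * k)) ≡ 0ℙ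
  cycle = begin
    parity (tally 1ℙ (λ i → F i ℙ.+ F (suc i)) (2 * k))  ≡⟨ parity-tally-telescope F (2 * k) ⟩
    F 0 ℙ.+ F (2 * k)                                    ≡⟨ cong (F 0 ℙ.+_) F-closed ⟩
    F 0 ℙ.+ F 0                                          ≡⟨ ℙ.p+p≡0ℙ (F 0) ⟩
    0ℙ                                                   ∎

möbius-not-cordial : ∀ q f → ¬ Cordial (möbiusLadder (2 + q * 4)) f
möbius-not-cordial q f (fr , ba) = contradiction 1ℙ≡0ℙ λ ()
  where
  k = 2 + q * 4
  G = möbiusLadder k
  #v₁≡k : #vertices G f 1ℙ ≡ k
  #v₁≡k = roughlyEqual⇒half (#vertices G f 0ℙ) _ fr
    (trans (count-total f (allFin (2 * k))) (length-tabulate {n = 2 * k} id))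
  -- Half of 3k is written as 3 plus a multiple of 2, so that it is visibly odd.
  3k-half : ∀ q → 2 * (2 + q * 4) + (2 + q * 4) ≡ 2 * (3 + q * 3 * 2)
  3k-half = solve-∀
  #e₁≡3k/2 : #edges G f 1ℙ ≡ 3 + q * 3 * 2
  #e₁≡3k/2 = roughlyEqual⇒half (#edges G f 0ℙ) _ ba
    (trans (count-total (edgeLabel f) (edges G)) (trans (length-möbius-edges k) (3k-half q)))
  parity-*even : ∀ m n → parity n ≡ 0ℙ → parity (m * n) ≡ 0ℙ
  parity-*even m n even = trans (ℙ.*-homo-* m n) (trans (cong (parity m ℙ.*_) even) (ℙ.*-zeroʳ (parity m)))
  1ℙ≡0ℙ : 1ℙ ≡ 0ℙ
  1ℙ≡0ℙ = begin
    1ℙ                             ≡⟨ cong (1ℙ ℙ.+_) (parity-*even (q * 3) 2 refl) ⟨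
    1ℙ ℙ.+ parity (q * 3 * 2)      ≡⟨ ℙ.+-homo-+ 3 (q * 3 * 2) ⟨
    parity (3 + q * 3 * 2)         ≡⟨ cong parity #e₁≡3k/2 ⟨
    parity (#edges G f 1ℙ)         ≡⟨ parity-#edges-möbius k f ⟩
    parity (#vertices G f 1ℙ)      ≡⟨ cong parity #v₁≡k ⟩
    -- `parity` strips two successors at a time, so `parity k` computes to this.
    parity (q * 4)                 ≡⟨ parity-*even q 4 refl ⟩
    0ℙ                             ∎

-- Labelings given by two rows

join : ∀ {A : Set} → ℕ → (ℕ → A) → (ℕ → A) → ℕ → A
join zero    a b n       = b n
join (suc k) a b zero    = a zero
join (suc k) a b (suc n) = join k (a ∘ suc) b n

-- Index `k` already belongs to `b`. The hypothesis brings it into the range of `a`, so that the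
-- passage between the rows counts as the last step of `a`.
join-≤ : ∀ {A : Set} k {a b : ℕ → A} → a k ≡ b 0 → ∀ {i} → i ≤ k → join k a b i ≡ a i
join-≤ zero    eq z≤n       = sym eq
join-≤ (suc k) eq z≤n       = refl
join-≤ (suc k) eq (s≤s i≤k) = join-≤ k eq i≤k

join-+ : ∀ {A : Set} k (a b : ℕ → A) i → join k a b (k + i) ≡ b i
join-+ zero    a b i = refl
join-+ (suc k) a b i = join-+ k (a ∘ suc) b i

-- The labeling with rows a and b; the closing conditions say that
-- the column after the last one is the first one upside down.
module Rows (k : ℕ) (a b : ℕ → Parity) (a-closed : a k ≡ b 0) (b-closed : b k ≡ a 0) where

  F : ℕ → Parity
  F = join k a b

  rows : Labeling (möbiusLadder k)
  rows = F ∘ toℕ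

  F-closed : F (2 * k) ≡ F 0
  F-closed = begin
    F (2 * k)  ≡⟨ cong F (2*k≡k+k k) ⟩
    F (k + k)  ≡⟨ join-+ k a b k ⟩
    b k        ≡⟨ b-closed ⟩
    a 0        ≡⟨ join-≤ k a-closed z≤n ⟨
    F 0        ∎

  #vertices-rows : ∀ c → #vertices (möbiusLadder k) rows c ≡ tally c a k + tally c b k
  #vertices-rows c = begin
    #vertices (möbiusLadder k) rows c        ≡⟨ #vertices-möbius k rows F (λ _ → refl) F-closed c ⟩
    tally c F (2 * k)                        ≡⟨ cong (tally c F) (2*k≡k+k k) ⟩
    tally c F (k + k)                        ≡⟨ tally-+ c F k k ⟩
    tally c F k + tally c (F ∘ (k +_)) k     ≡⟨ cong₂ _+_ (tally-cong c k (λ i i<k → join-≤ k a-closed (<⇒≤ i<k)))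
                                                          (tally-cong c k (λ i _ → join-+ k a b i)) ⟩
    tally c a k + tally c b k                ∎

  #edges-rows : ∀ c → #edges (möbiusLadder k) rows c ≡
    tally c (λ i → a i ℙ.+ a (suc i)) k + tally c (λ i → b i ℙ.+ b (suc i)) k + tally c (λ i → a i ℙ.+ b i) k
  #edges-rows c = begin
    #edges (möbiusLadder k) rows c
      ≡⟨ #edges-möbius k rows F (λ _ → refl) F-closed c ⟩
    tally c (λ i → F i ℙ.+ F (suc i)) (2 * k) + tally c (λ i → F i ℙ.+ F (k + i)) k
      ≡⟨ cong₂ _+_ cycle (tally-cong c k λ i i<k → cong₂ ℙ._+_ (join-≤ k a-closed (<⇒≤ i<k)) (join-+ k a b i)) ⟩
    tally c (λ i → a i ℙ.+ a (suc i)) k + tally c (λ i → b i ℙ.+ b (suc i)) k + tally c (λ i → a i ℙ.+ b i) k ∎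
    where
    lower-step : ∀ i → F (k + i) ℙ.+ F (suc (k + i)) ≡ b i ℙ.+ b (suc i)
    lower-step i = cong₂ ℙ._+_ (join-+ k a b i)
      (trans (cong F (sym (+-suc k i))) (join-+ k a b (suc i)))
    cycle : tally c (λ i → F i ℙ.+ F (suc i)) (2 * k) ≡
            tally c (λ i → a i ℙ.+ a (suc i)) k + tally c (λ i → b i ℙ.+ b (suc i)) k
    cycle = trans (cong (tally c _) (2*k≡k+k k)) (trans (tally-+ c _ k k)
      (cong₂ _+_
        -- For i = k - 1 the endpoint `suc i` lies in row `b`; `i<k`, read as `suc i ≤ k`, still
        -- yields `a (suc i)`.
        (tally-cong c k λ i i<k → cong₂ ℙ._+_ (join-≤ k a-closed (<⇒≤ i<k)) (join-≤ k a-closed i<k))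
        (tally-cong c k λ i _ → lower-step i)))

-- The periodic labeling

wave : ℕ → Parity
wave 0 = 0ℙ
wave 1 = 0ℙ
wave 2 = 1ℙ
wave 3 = 1ℙ
wave (suc (suc (suc (suc n)))) = wave n

wave-closed : ∀ i q → wave (q * 4 + i) ≡ wave i
wave-closed i zero    = refl
wave-closed i (suc q) = wave-closed i q

upper : Parity → ℕ → Parity
upper y 0             = 0ℙ
upper y 1             = y
upper y (suc (suc n)) = wave n

-- From column 2 on, this is the wave one step ahead of `upper`, so the columns run through all four
-- pairs of labels.
lower : ℕ → Parity
lower 0             = 0ℙ
lower 1             = 1ℙ
lower (suc (suc n)) = wave (suc n)

-- Each of the `q` blocks of four after the first two terms contains `c` twice. An imbalance between
-- the labels is thus confined to those two terms.
tally-eventually-balanced : ∀ c {h} → (∀ i → h (6 + i) ≡ h (2 + i)) →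
  tally c (h ∘ (2 +_)) 4 ≡ 2 → ∀ q → tally c h (2 + q * 4) ≡ tally c h 2 + q * 2
tally-eventually-balanced c {h} period half q = begin
  tally c h (2 + q * 4)                           ≡⟨ tally-+ c h 2 (q * 4) ⟩
  tally c h 2 + tally c (h ∘ (2 +_)) (q * 4)      ≡⟨ cong (tally c h 2 +_) (tally-periodic c 4 period q) ⟩
  tally c h 2 + q * tally c (h ∘ (2 +_)) 4        ≡⟨ cong (λ t → tally c h 2 + q * t) half ⟩
  tally c h 2 + q * 2                             ∎

module WaveLabeling (y : Parity) (q : ℕ) where

  k = 2 + q * 4

  open Rows k (upper y) lower
    -- `upper y k` and `lower k` reduce to `wave (q * 4)` and `wave (1 + q * 4)`, both 0 like the
    -- two labels of the first column.
    (trans (cong wave (sym (+-identityʳ (q * 4)))) (wave-closed 0 q))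
    (trans (cong wave (+-comm 1 (q * 4))) (wave-closed 1 q))
    public using (rows; #vertices-rows; #edges-rows)

  #vertices-wave : ∀ c → #vertices (möbiusLadder k) rows c ≡
    (tally c (upper y) 2 + tally c lower 2) + q * 4
  #vertices-wave c = begin
    #vertices (möbiusLadder k) rows c        ≡⟨ #vertices-rows c ⟩
    tally c (upper y) k + tally c lower k
      ≡⟨ cong₂ _+_ (tally-eventually-balanced c {upper y} (λ _ → refl) (half-upper c) q)
                   (tally-eventually-balanced c {lower} (λ _ → refl) (half-lower c) q) ⟩
    (tally c (upper y) 2 + q * 2) + (tally c lower 2 + q * 2)
      ≡⟨ collect (tally c (upper y) 2) (tally c lower 2) q ⟩
    (tally c (upper y) 2 + tally c lower 2) + q * 4 ∎
    where
    half-upper : ∀ c → tally c wave 4 ≡ 2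
    half-upper 0ℙ = refl
    half-upper 1ℙ = refl
    half-lower : ∀ c → tally c (wave ∘ suc) 4 ≡ 2
    half-lower 0ℙ = refl
    half-lower 1ℙ = refl
    collect : ∀ s t q → (s + q * 2) + (t + q * 2) ≡ (s + t) + q * 4
    collect = solve-∀

  upperStep lowerStep rung : ℕ → Parity
  upperStep i = upper y i ℙ.+ upper y (suc i)
  lowerStep i = lower i ℙ.+ lower (suc i)
  rung i      = upper y i ℙ.+ lower i

  #edges-wave : ∀ c → #edges (möbiusLadder k) rows c ≡
    (tally c upperStep 2 + tally c lowerStep 2 + tally c rung 2) + q * 6
  #edges-wave c = begin
    #edges (möbiusLadder k) rows c                          ≡⟨ #edges-rows c ⟩
    tally c upperStep k + tally c lowerStep k + tally c rung k
      ≡⟨ cong₂ _+_ (cong₂ _+_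
           (tally-eventually-balanced c {upperStep} (λ _ → refl) (half-upper c) q)
           (tally-eventually-balanced c {lowerStep} (λ _ → refl) (half-lower c) q))
           -- From column 2 on, a rung joins labels `wave n` and `wave (suc n)`, just as a step of
           -- the upper row does, so `half-upper` serves again.
           (tally-eventually-balanced c {rung} (λ _ → refl) (half-upper c) q) ⟩
    (tally c upperStep 2 + q * 2) + (tally c lowerStep 2 + q * 2) + (tally c rung 2 + q * 2)
      ≡⟨ collect (tally c upperStep 2) (tally c lowerStep 2) (tally c rung 2) q ⟩
    (tally c upperStep 2 + tally c lowerStep 2 + tally c rung 2) + q * 6 ∎
    where
    half-upper : ∀ c → tally c (λ i → wave i ℙ.+ wave (suc i)) 4 ≡ 2
    half-upper 0ℙ = refl
    half-upper 1ℙ = refl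
    half-lower : ∀ c → tally c (λ i → wave (suc i) ℙ.+ wave (2 + i)) 4 ≡ 2
    half-lower 0ℙ = refl
    half-lower 1ℙ = refl
    collect : ∀ s t u q → (s + q * 2) + (t + q * 2) + (u + q * 2) ≡ (s + t + u) + q * 6
    collect = solve-∀

-- The two deficiencies

ced-möbius : ∀ q → Ced (möbiusLadder (6 + q * 4)) 1
ced-möbius q =
  (rows , friendly , (es , refl , friendly , balanced) , λ n → needs-edge n rows) ,
  λ { n (f , _ , cordial , _) → needs-edge n f cordial }
  where
  open WaveLabeling 1ℙ (suc q)
  G = möbiusLadder k

  -- Serves both minima: the inner one for `rows` and the outer one over all friendly labelings.
  needs-edge : ∀ n f → ∃[ es ] length es ≡ n × Cordial (addEdges G es) f → 1 ≤ n
  needs-edge zero    f ([] , _ , cordial) =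
    contradiction (0-edges-cordial G {f} cordial) (möbius-not-cordial (suc q) f)
  needs-edge (suc n) f _                  = s≤s z≤n

  es : List (Edge (2 * k))
  -- Vertices 0 and 2 are both labeled 0, so the new edge has label 0. It turns 2 against 4 edges,
  -- apart from the balanced blocks, into 3 against 4.
  es = edge zero (suc (suc zero)) (λ ()) ∷ []

  friendly : Friendly G rows
  friendly = subst₂ RoughlyEqual (sym (#vertices-wave 0ℙ)) (sym (#vertices-wave 1ℙ)) (n≈n (2 + suc q * 4))

  balanced : EdgeBalanced (addEdges G es) rows
  balanced = subst₂ RoughlyEqual (sym (e 0ℙ)) (sym (e 1ℙ))
    (subst₂ RoughlyEqual (+-comm 1 (2 + suc q * 6)) (sym (+-identityʳ (4 + suc q * 6))) (n≈1+n (3 + suc q * 6)))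
    where
    e : ∀ c → #edges (addEdges G es) rows c ≡
      (tally c upperStep 2 + tally c lowerStep 2 + tally c rung 2) + suc q * 6 + count (edgeLabel rows) c es
    e c = trans (#edges-addEdges G rows c es) (cong (_+ count (edgeLabel rows) c es) (#edges-wave c))

cvd-möbius : ∀ q → Cvd (möbiusLadder (2 + q * 4)) [ 1 ]
cvd-möbius q =
  (rows , balanced , (g , friendly , balanced′) , λ p → needs-vertex p rows) ,
  λ { p (f , _ , cordial , _) → needs-vertex p f cordial }
  where
  open WaveLabeling 0ℙ q
  G = möbiusLadder k

  needs-vertex : ∀ p f → ∃[ g ] Cordial (addVertices G p) (extend G f {p} g) → 1 ≤ p
  needs-vertex zero    f (g , cordial) =
    contradiction (0-vertices-cordial G {f} {g} cordial) (möbius-not-cordial q f)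
  needs-vertex (suc p) f _             = s≤s z≤n

  -- Label 0 occurs on 3 + 4q vertices and label 1 on 1 + 4q, so a new vertex labeled 1 leaves 3 +
  -- 4q against 2 + 4q.
  g : Fin 1 → Parity
  g _ = 1ℙ

  balanced : EdgeBalanced G rows
  -- In the first two columns the upper steps have labels 0, 0, the lower steps 1, 1 and the rungs
  -- 0, 1: three of each.
  balanced = subst₂ RoughlyEqual (sym (#edges-wave 0ℙ)) (sym (#edges-wave 1ℙ)) (n≈n (3 + q * 6))

  balanced′ : EdgeBalanced (addVertices G 1) (extend G rows g)
  balanced′ = subst₂ RoughlyEqual
    (sym (#edges-addVertices G rows g 0ℙ)) (sym (#edges-addVertices G rows g 1ℙ)) balanced

  friendly : Friendly (addVertices G 1) (extend G rows g)
  friendly = subst₂ RoughlyEqual (sym (v 0ℙ)) (sym (v 1ℙ))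
    (subst₂ RoughlyEqual (sym (+-identityʳ (3 + q * 4))) (+-comm 1 (1 + q * 4))
      (subst (_≤ 1) (∣-∣-comm (2 + q * 4) (3 + q * 4)) (n≈1+n (2 + q * 4))))
    where
    v : ∀ c → #vertices (addVertices G 1) (extend G rows g) c ≡
      (tally c (upper 0ℙ) 2 + tally c lower 2) + q * 4 + count g c (allFin 1)
    v c = trans (#vertices-addVertices G rows g c) (cong (_+ count g c (allFin 1)) (#vertices-wave c))

theorem5 : ∀ (k : ℕ) → k % 4 ≡ 2 → 6 ≤ k →
    Ced (möbiusLadder k) 1 × Cvd (möbiusLadder k) [ 1 ]
theorem5 k k%4≡2 6≤k = split (k / 4) (trans (m≡m%n+[m/n]*n k 4) (cong (_+ k / 4 * 4) k%4≡2)) 6≤k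
  where
  -- `k` is generalized so that matching on the equation replaces it by `2 + q * 4`. The bound
  -- excludes k = 2, and a successor `q` gives the form `6 + q * 4`.
  split : ∀ {k} q → k ≡ 2 + q * 4 → 6 ≤ k → Ced (möbiusLadder k) 1 × Cvd (möbiusLadder k) [ 1 ]
  split zero    refl (s≤s (s≤s ()))
  split (suc q) refl _ = ced-möbius q , cvd-möbius (suc q)
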